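{- Let $M$ be a binary matroid. Then $P(M)$ has no nontrivial hyperplane split.
   Context: A matroid is binary if it is representable over $\mathbb{F}_2$. For a matroid $N$ on $E=\{1,\dots,n\}$, $P(N)=\mathrm{conv}\{\sum_{i\in B}e_i : B \text{ a base of } N\}\subset\mathbb{R}^n$. A hyperplane split of $P(N)$ is an expression $P(N)=P(N_1)\cup P(N_2)$ with $N_1,N_2$ matroids on $E$ such that $P(N_1)\cap P(N_2)$ is a face of both $P(N_1)$ and $P(N_2)$; it is nontrivial if $P(N_1)\neq P(N)$ and $P(N_2)\neq P(N)$. -}

module Defs where

open import Algebra.Bundles.Raw using (RawMonoid)
import Algebra.Definitions.RawMonoid as RawMonoidDefs
open import Data.Bool.Base using (if_then_else_)
open import Data.Fin.Base using (Fin)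
open import Data.Fin.Subset using (Subset; _∈_; _∉_; _⊆_; _∪_; _-_; ⁅_⁆)
open import Data.Nat.Base as ℕ using (ℕ)
import Data.Nat.Properties as ℕ
open import Data.Parity.Base as ℙ using (Parity; 0ℙ)
open import Data.Product.Base using (Σ-syntax; ∃; _×_; _,_)
open import Data.Rational.Base as ℚ using (ℚ; 0ℚ; 1ℚ; ½; ∣_∣; 1/_; Positive; NonZero)
import Data.Rational.Properties as ℚ
open import Data.Rational.Solver using (module +-*-Solver)
open import Data.Vec.Base using (lookup)
open import Data.Vec.Functional using (Vector)
open import Function.Bundles using (_⇔_)
open import Level using (0ℓ)
open import Relation.Binary.PropositionalEquality
  using (_≡_; refl; sym; trans; cong; cong₂; subst)
open import Relation.Nullary.Negation using (¬_)
import Relation.Unary as Pred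
open Pred using (Pred; _≐_)

-- Real numbers are Cauchy sequences of rationals, and _≃_ is their equality.

IsCauchy : (ℕ → ℚ) → Set
IsCauchy s = ∀ ε → 0ℚ ℚ.< ε →
  Σ[ N ∈ ℕ ] (∀ m n → N ℕ.≤ m → N ℕ.≤ n → ∣ s m ℚ.- s n ∣ ℚ.≤ ε)

record ℝ : Set where
  constructor mkℝ
  field
    seq      : ℕ → ℚ
    isCauchy : IsCauchy seq

open ℝ public

infix 4 _≃_ _≤_

_≃_ : ℝ → ℝ → Set
x ≃ y = ∀ ε → 0ℚ ℚ.< ε →
  Σ[ N ∈ ℕ ] (∀ n → N ℕ.≤ n → ∣ seq x n ℚ.- seq y n ∣ ℚ.≤ ε)

_≤_ : ℝ → ℝ → Set
x ≤ y = ∀ ε → 0ℚ ℚ.< ε →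
  Σ[ N ∈ ℕ ] (∀ n → N ℕ.≤ n → seq x n ℚ.≤ seq y n ℚ.+ ε)

-- Only the Cauchy proofs are abstract: _≤_ and _≃_ look at seq alone.
private abstract
  const-isCauchy : ∀ q → IsCauchy (λ _ → q)
  const-isCauchy q ε 0<ε = 0 , λ _ _ _ _ →
    subst (ℚ._≤ ε) (sym (cong ∣_∣ (ℚ.+-inverseʳ q))) (ℚ.<⇒≤ 0<ε)

  half-pos : ∀ ε → 0ℚ ℚ.< ε → 0ℚ ℚ.< ε ℚ.* ½
  half-pos ε 0<ε = subst (ℚ._< ε ℚ.* ½) (ℚ.*-zeroˡ ½) (ℚ.*-monoˡ-<-pos ½ 0<ε)

  halves : ∀ ε → ε ℚ.* ½ ℚ.+ ε ℚ.* ½ ≡ ε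
  halves ε = trans (sym (ℚ.*-distribˡ-+ ε ½ ½)) (ℚ.*-identityʳ ε)

  +-diff : ∀ a b c d → (a ℚ.+ b) ℚ.- (c ℚ.+ d) ≡ (a ℚ.- c) ℚ.+ (b ℚ.- d)
  +-diff = solve 4 (λ a b c d → (a :+ b) :- (c :+ d) := (a :- c) :+ (b :- d)) refl
    where open +-*-Solver

  *-diff : ∀ a b c d → (a ℚ.* b) ℚ.- (c ℚ.* d) ≡ a ℚ.* (b ℚ.- d) ℚ.+ d ℚ.* (a ℚ.- c)
  *-diff = solve 4 (λ a b c d → (a :* b) :- (c :* d) := a :* (b :- d) :+ d :* (a :- c)) refl
    where open +-*-Solver

  split-diff : ∀ a b → (a ℚ.- b) ℚ.+ b ≡ a
  split-diff = solve 2 (λ a b → (a :- b) :+ b := a) refl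
    where open +-*-Solver

  0<1 : 0ℚ ℚ.< 1ℚ
  0<1 = ℚ.positive⁻¹ 1ℚ

  +-estimate : ∀ a b c d ε →
    ∣ a ℚ.- c ∣ ℚ.≤ ε ℚ.* ½ → ∣ b ℚ.- d ∣ ℚ.≤ ε ℚ.* ½ → ∣ (a ℚ.+ b) ℚ.- (c ℚ.+ d) ∣ ℚ.≤ ε
  +-estimate a b c d ε a-c≤ b-d≤ = begin
      ∣ (a ℚ.+ b) ℚ.- (c ℚ.+ d) ∣        ≡⟨ cong ∣_∣ (+-diff a b c d) ⟩
      ∣ (a ℚ.- c) ℚ.+ (b ℚ.- d) ∣        ≤⟨ ℚ.∣p+q∣≤∣p∣+∣q∣ (a ℚ.- c) (b ℚ.- d) ⟩
      ∣ a ℚ.- c ∣ ℚ.+ ∣ b ℚ.- d ∣        ≤⟨ ℚ.+-mono-≤ a-c≤ b-d≤ ⟩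
      ε ℚ.* ½ ℚ.+ ε ℚ.* ½                ≡⟨ halves ε ⟩
      ε                                  ∎
    where open ℚ.≤-Reasoning

  +-isCauchy : ∀ s t → IsCauchy s → IsCauchy t → IsCauchy (λ n → s n ℚ.+ t n)
  +-isCauchy s t cs ct ε 0<ε =
    let N₁ , s-close = cs (ε ℚ.* ½) (half-pos ε 0<ε)
        N₂ , t-close = ct (ε ℚ.* ½) (half-pos ε 0<ε)
    in N₁ ℕ.⊔ N₂ , λ m n N≤m N≤n →
      +-estimate (s m) (t m) (s n) (t n) ε
        (s-close m n (ℕ.m⊔n≤o⇒m≤o N₁ N₂ N≤m) (ℕ.m⊔n≤o⇒m≤o N₁ N₂ N≤n))
        (t-close m n (ℕ.m⊔n≤o⇒n≤o N₁ N₂ N≤m) (ℕ.m⊔n≤o⇒n≤o N₁ N₂ N≤n))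

  0<1+∣p∣ : ∀ p → 0ℚ ℚ.< 1ℚ ℚ.+ ∣ p ∣
  0<1+∣p∣ p = ℚ.<-≤-trans 0<1
    (subst (ℚ._≤ 1ℚ ℚ.+ ∣ p ∣) (ℚ.+-identityʳ 1ℚ) (ℚ.+-monoʳ-≤ 1ℚ (ℚ.0≤∣p∣ p)))

  bound-estimate : ∀ a b → ∣ a ℚ.- b ∣ ℚ.≤ 1ℚ → ∣ a ∣ ℚ.≤ 1ℚ ℚ.+ ∣ b ∣
  bound-estimate a b a-b≤1 = begin
      ∣ a ∣                    ≡⟨ cong ∣_∣ (split-diff a b) ⟨
      ∣ (a ℚ.- b) ℚ.+ b ∣      ≤⟨ ℚ.∣p+q∣≤∣p∣+∣q∣ (a ℚ.- b) b ⟩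
      ∣ a ℚ.- b ∣ ℚ.+ ∣ b ∣    ≤⟨ ℚ.+-monoˡ-≤ ∣ b ∣ a-b≤1 ⟩
      1ℚ ℚ.+ ∣ b ∣             ∎
    where open ℚ.≤-Reasoning

  eventually-bounded : ∀ s → IsCauchy s →
    Σ[ K ∈ ℚ ] 0ℚ ℚ.< K × Σ[ N ∈ ℕ ] (∀ n → N ℕ.≤ n → ∣ s n ∣ ℚ.≤ K)
  eventually-bounded s cs =
    let N , close = cs 1ℚ 0<1
    in 1ℚ ℚ.+ ∣ s N ∣ , 0<1+∣p∣ (s N) , N
     , λ n N≤n → bound-estimate (s n) (s N) (close n N N≤n ℕ.≤-refl)

  shrink : ∀ K ε → 0ℚ ℚ.< K → 0ℚ ℚ.< ε → Σ[ δ ∈ ℚ ] 0ℚ ℚ.< δ × K ℚ.* δ ≡ ε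
  shrink K ε 0<K 0<ε = 1/ K ℚ.* ε , 0<δ , Kδ≡ε
    where
    instance
      K-pos : Positive K
      K-pos = ℚ.positive 0<K
      K-nonZero : NonZero K
      K-nonZero = ℚ.pos⇒nonZero K
      1/K-pos : Positive (1/ K)
      1/K-pos = ℚ.1/pos⇒pos K
    0<δ : 0ℚ ℚ.< 1/ K ℚ.* ε
    0<δ = subst (ℚ._< 1/ K ℚ.* ε) (ℚ.*-zeroʳ (1/ K)) (ℚ.*-monoʳ-<-pos (1/ K) 0<ε)
    Kδ≡ε : K ℚ.* (1/ K ℚ.* ε) ≡ ε
    Kδ≡ε = trans (sym (ℚ.*-assoc K (1/ K) ε))
             (trans (cong (ℚ._* ε) (ℚ.*-inverseʳ K)) (ℚ.*-identityˡ ε))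

  ∣*∣≤ : ∀ p q {K δ} → ∣ p ∣ ℚ.≤ K → ∣ q ∣ ℚ.≤ δ → ∣ p ℚ.* q ∣ ℚ.≤ K ℚ.* δ
  ∣*∣≤ p q {K} {δ} p≤K q≤δ = begin
      ∣ p ℚ.* q ∣      ≡⟨ ℚ.∣p*q∣≡∣p∣*∣q∣ p q ⟩
      ∣ p ∣ ℚ.* ∣ q ∣  ≤⟨ ℚ.*-monoʳ-≤-nonNeg ∣ q ∣ {{ℚ.∣-∣-nonNeg q}} p≤K ⟩
      K ℚ.* ∣ q ∣      ≤⟨ ℚ.*-monoˡ-≤-nonNeg K {{ℚ.nonNegative (ℚ.≤-trans (ℚ.0≤∣p∣ p) p≤K)}} q≤δ ⟩
      K ℚ.* δ          ∎
    where open ℚ.≤-Reasoning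

  *-estimate : ∀ a b c d K δ L η ε →
    ∣ a ∣ ℚ.≤ K → ∣ b ℚ.- d ∣ ℚ.≤ δ → ∣ d ∣ ℚ.≤ L → ∣ a ℚ.- c ∣ ℚ.≤ η →
    K ℚ.* δ ≡ ε ℚ.* ½ → L ℚ.* η ≡ ε ℚ.* ½ → ∣ a ℚ.* b ℚ.- c ℚ.* d ∣ ℚ.≤ ε
  *-estimate a b c d K δ L η ε a≤K b-d≤δ d≤L a-c≤η Kδ≡ Lη≡ = begin
      ∣ a ℚ.* b ℚ.- c ℚ.* d ∣
        ≡⟨ cong ∣_∣ (*-diff a b c d) ⟩
      ∣ a ℚ.* (b ℚ.- d) ℚ.+ d ℚ.* (a ℚ.- c) ∣
        ≤⟨ ℚ.∣p+q∣≤∣p∣+∣q∣ (a ℚ.* (b ℚ.- d)) (d ℚ.* (a ℚ.- c)) ⟩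
      ∣ a ℚ.* (b ℚ.- d) ∣ ℚ.+ ∣ d ℚ.* (a ℚ.- c) ∣
        ≤⟨ ℚ.+-mono-≤ (∣*∣≤ a (b ℚ.- d) a≤K b-d≤δ) (∣*∣≤ d (a ℚ.- c) d≤L a-c≤η) ⟩
      K ℚ.* δ ℚ.+ L ℚ.* η
        ≡⟨ cong₂ ℚ._+_ Kδ≡ Lη≡ ⟩
      ε ℚ.* ½ ℚ.+ ε ℚ.* ½
        ≡⟨ halves ε ⟩
      ε ∎
    where open ℚ.≤-Reasoning

  *-isCauchy : ∀ s t → IsCauchy s → IsCauchy t → IsCauchy (λ n → s n ℚ.* t n)
  *-isCauchy s t cs ct ε 0<ε =
    let ε/2 = ε ℚ.* ½
        K , 0<K , N₁ , s≤K = eventually-bounded s cs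
        L , 0<L , N₂ , t≤L = eventually-bounded t ct
        δ , 0<δ , Kδ≡ = shrink K ε/2 0<K (half-pos ε 0<ε)
        η , 0<η , Lη≡ = shrink L ε/2 0<L (half-pos ε 0<ε)
        N₃ , t-close = ct δ 0<δ
        N₄ , s-close = cs η 0<η
    in (N₁ ℕ.⊔ N₂) ℕ.⊔ (N₃ ℕ.⊔ N₄) , λ m n N≤m N≤n →
      let m≥₁₂ = ℕ.m⊔n≤o⇒m≤o (N₁ ℕ.⊔ N₂) (N₃ ℕ.⊔ N₄) N≤m
          m≥₃₄ = ℕ.m⊔n≤o⇒n≤o (N₁ ℕ.⊔ N₂) (N₃ ℕ.⊔ N₄) N≤m
          n≥₁₂ = ℕ.m⊔n≤o⇒m≤o (N₁ ℕ.⊔ N₂) (N₃ ℕ.⊔ N₄) N≤n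
          n≥₃₄ = ℕ.m⊔n≤o⇒n≤o (N₁ ℕ.⊔ N₂) (N₃ ℕ.⊔ N₄) N≤n
      in *-estimate (s m) (t m) (s n) (t n) K δ L η ε
           (s≤K m (ℕ.m⊔n≤o⇒m≤o N₁ N₂ m≥₁₂))
           (t-close m n (ℕ.m⊔n≤o⇒m≤o N₃ N₄ m≥₃₄) (ℕ.m⊔n≤o⇒m≤o N₃ N₄ n≥₃₄))
           (t≤L n (ℕ.m⊔n≤o⇒n≤o N₁ N₂ n≥₁₂))
           (s-close m n (ℕ.m⊔n≤o⇒n≤o N₃ N₄ m≥₃₄) (ℕ.m⊔n≤o⇒n≤o N₃ N₄ n≥₃₄))
           Kδ≡ Lη≡

fromℚ : ℚ → ℝ
fromℚ q = mkℝ (λ _ → q) (const-isCauchy q)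

0ℝ 1ℝ : ℝ
0ℝ = fromℚ 0ℚ
1ℝ = fromℚ 1ℚ

infixl 6 _+_
infixl 7 _*_

_+_ _*_ : ℝ → ℝ → ℝ
x + y = mkℝ (λ n → seq x n ℚ.+ seq y n) (+-isCauchy (seq x) (seq y) (isCauchy x) (isCauchy y))
x * y = mkℝ (λ n → seq x n ℚ.* seq y n) (*-isCauchy (seq x) (seq y) (isCauchy x) (isCauchy y))

+-0ℝ-rawMonoid : RawMonoid 0ℓ 0ℓ
+-0ℝ-rawMonoid = record { _≈_ = _≃_ ; _∙_ = _+_ ; ε = 0ℝ }

open RawMonoidDefs +-0ℝ-rawMonoid public using () renaming (sum to sumℝ)

Point : ℕ → Set
Point = Vector ℝ

infix 4 _≃ᵛ_

_≃ᵛ_ : ∀ {n} → Point n → Point n → Set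
x ≃ᵛ y = ∀ i → x i ≃ y i

infix 8 _·_

_·_ : ∀ {n} → Point n → Point n → ℝ
c · x = sumℝ (λ i → c i * x i)

conv : ∀ {n} → Pred (Point n) 0ℓ → Pred (Point n) 0ℓ
conv V x =
  Σ[ k ∈ ℕ ] Σ[ v ∈ (Fin k → Point _) ] Σ[ w ∈ (Fin k → ℝ) ]
    (∀ j → V (v j)) × (∀ j → 0ℝ ≤ w j) × sumℝ w ≃ 1ℝ
    × x ≃ᵛ (λ i → sumℝ (λ j → w j * v j i))

-- F is cut out of Q by a valid inequality c · x ≤ δ.  As usual for
-- polytopes, this makes ∅ and Q themselves faces of Q.
IsFaceOf : ∀ {n} → Pred (Point n) 0ℓ → Pred (Point n) 0ℓ → Set
IsFaceOf {n} F Q = Σ[ c ∈ Point n ] Σ[ δ ∈ ℝ ]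
  (∀ x → Q x → c · x ≤ δ) × F ≐ (λ x → Q x × c · x ≃ δ)

record Matroid (n : ℕ) : Set₁ where
  field
    Base     : Pred (Subset n) 0ℓ
    nonempty : ∃ Base
    exchange : ∀ {A B} → Base A → Base B → ∀ {x} → x ∈ A → x ∉ B →
               Σ[ y ∈ Fin n ] y ∈ B × y ∉ A × Base ((A - x) ∪ ⁅ y ⁆)

  Independent : Pred (Subset n) 0ℓ
  Independent S = Σ[ B ∈ Subset n ] Base B × S ⊆ B

open Matroid public

-- Parity, with its addition and multiplication, is the field 𝔽₂.

open RawMonoidDefs ℙ.+-0-rawMonoid public using () renaming (sum to sumℙ)

-- Linear independence of the family of columns of A indexed by S, so
-- that two equal columns with distinct indices are dependent.
ColumnsIndependent : ∀ {m n} → (Fin m → Fin n → Parity) → Subset n → Set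
ColumnsIndependent {n = n} A S = ∀ (c : Fin n → Parity) → (∀ i → i ∉ S → c i ≡ 0ℙ) →
  (∀ r → sumℙ (λ i → c i ℙ.* A r i) ≡ 0ℙ) → ∀ i → c i ≡ 0ℙ

Binary : ∀ {n} → Matroid n → Set
Binary {n} M = Σ[ m ∈ ℕ ] Σ[ A ∈ (Fin m → Fin n → Parity) ]
  (∀ S → Independent M S ⇔ ColumnsIndependent A S)

-- The point ∑_{i ∈ B} eᵢ
incidence : ∀ {n} → Subset n → Point n
incidence B i = if lookup B i then 1ℝ else 0ℝ

P : ∀ {n} → Matroid n → Pred (Point n) 0ℓ
P N = conv λ v → Σ[ B ∈ Subset _ ] Base N B × v ≃ᵛ incidence B

-- P N ≡ P N₁ ∪ P N₂ is stated with the classical union: constructively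
-- one cannot decide on which side of a hyperplane a real point lies, so
-- asking for P N ⊆ P N₁ ∪ P N₂ would exclude genuine splits.
record HyperplaneSplit {n} (N N₁ N₂ : Matroid n) : Set where
  field
    ⊇-union : P N₁ Pred.∪ P N₂ Pred.⊆ P N
    ⊆-union : P N Pred.⊆ Pred.∁ (Pred.∁ (P N₁ Pred.∪ P N₂))
    face₁   : IsFaceOf (P N₁ Pred.∩ P N₂) (P N₁)
    face₂   : IsFaceOf (P N₁ Pred.∩ P N₂) (P N₂)

Nontrivial : ∀ {n} {N N₁ N₂ : Matroid n} → HyperplaneSplit N N₁ N₂ → Set
Nontrivial {N = N} {N₁} {N₂} _ = ¬ (P N₁ ≐ P N) × ¬ (P N₂ ≐ P N)

{-# OPTIONS --safe #-}
module Submission where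

-- The vertices of P N are the incidence points of bases, so in a split the
-- bases of M are covered by those of N₁ and N₂, and no base A of N₁ alone is
-- adjacent to a base C of N₂ alone (the midpoint of an edge of P M lies in a
-- subpolytope only if both its ends do).  If both kinds of base exist, take A
-- and C with A ─ C smallest, so ∣ A ─ C ∣ ≥ 2.  By minimality every base of M
-- of the form C - c + d, with c ∈ C ─ A and d ∈ A ─ C, is a base of N₁;
-- exchanging in N₁, where C is not a base, shows that all these sets are bases.
-- Over 𝔽₂ all d ∈ A ─ C are then congruent to ∑ (C ─ A) modulo the span of
-- A ∩ C, contradicting the independence of A.

open import Defs
open import Algebra.Bundles using (CommutativeSemiring; module CommutativeRing)
import Algebra.Properties.Semiring.Sum as SemiringSum
import Relation.Binary.Reasoning.Setoid as SetoidReasoning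
open import Data.Bool.Base using (Bool; true; false; if_then_else_)
import Data.Bool.Properties as Bool
open import Data.Empty using (⊥)
open import Data.Fin.Base using (Fin; zero; suc)
import Data.Fin.Properties as Fin
import Data.Fin.Subset as Subset
open import Data.Fin.Subset using (Subset; _∈_; _∉_; _⊆_; _∪_; _─_; _-_; ⁅_⁆)
open import Data.Fin.Subset.Properties
open import Data.Nat.Base as ℕ using (ℕ; zero; suc)
open import Data.Nat.Induction using (<-wellFounded)
import Data.Nat.Properties as ℕ
open import Data.Parity.Base as ℙ using (Parity; 0ℙ; 1ℙ)
import Data.Parity.Properties as ℙ
open import Data.Product.Base using (Σ-syntax; ∃; _×_; _,_; proj₁; proj₂)
open import Data.Rational.Base as ℚ using (ℚ; 0ℚ; 1ℚ; ½; ∣_∣; 1/_)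
import Data.Rational.Properties as ℚ
open import Data.Rational.Solver using (module +-*-Solver)
open import Data.Sum.Base using (_⊎_; inj₁; inj₂; [_,_]′; fromInj₁; fromInj₂)
import Data.Sum.Base as Sum
open import Data.Vec.Base using (_∷_; []; lookup; there)
open import Data.Vec.Properties using ([]=⇒lookup; lookup⇒[]=)
open import Function.Base using (_∘_; id)
open import Function.Bundles using (module Equivalence)
open import Induction.WellFounded using (Acc; acc)
open import Level using (0ℓ)
open import Relation.Binary.PropositionalEquality
open import Relation.Binary.Structures using (IsEquivalence)
open import Relation.Nullary.Decidable using
  (Dec; yes; no; _×-dec_; _⊎-dec_; _→-dec_; ¬?; decidable-stable; from-yes; ¬¬-excluded-middle)
open import Relation.Nullary.Negation using (¬_; contradiction)
open import Relation.Unary using (Pred; Decidable; _≐_)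

private variable
  n : ℕ
  i x y : Fin n
  S T A C : Subset n

-- Limits of rational sequences

Null : (ℕ → ℚ) → Set
Null s = ∀ ε → 0ℚ ℚ.< ε → Σ[ N ∈ ℕ ] (∀ n → N ℕ.≤ n → ∣ s n ∣ ℚ.≤ ε)

Bounded : (ℕ → ℚ) → Set
Bounded s = Σ[ K ∈ ℚ ] 0ℚ ℚ.< K × Σ[ N ∈ ℕ ] (∀ n → N ℕ.≤ n → ∣ s n ∣ ℚ.≤ K)

half-pos : ∀ {ε} → 0ℚ ℚ.< ε → 0ℚ ℚ.< ½ ℚ.* ε
half-pos {ε} 0<ε = subst (ℚ._< ½ ℚ.* ε) (ℚ.*-zeroʳ ½) (ℚ.*-monoʳ-<-pos ½ 0<ε)

halves : ∀ p → ½ ℚ.* p ℚ.+ ½ ℚ.* p ≡ p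
halves p = trans (sym (ℚ.*-distribʳ-+ p ½ ½)) (ℚ.*-identityˡ p)

null-resp-≗ : ∀ {s t} → s ≗ t → Null s → Null t
null-resp-≗ s≗t s-null ε 0<ε with s-null ε 0<ε
... | N , bound = N , λ n N≤n → subst (λ q → ∣ q ∣ ℚ.≤ ε) (s≗t n) (bound n N≤n)

null-0 : Null (λ _ → 0ℚ)
null-0 ε 0<ε = 0 , λ _ _ → ℚ.<⇒≤ 0<ε

null-neg : ∀ {s} → Null s → Null (λ n → ℚ.- s n)
null-neg {s} s-null ε 0<ε with s-null ε 0<ε
... | N , bound = N , λ n N≤n → subst (ℚ._≤ ε) (sym (ℚ.∣-p∣≡∣p∣ (s n))) (bound n N≤n)

null-+ : ∀ {s t} → Null s → Null t → Null (λ n → s n ℚ.+ t n)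
null-+ {s} {t} s-null t-null ε 0<ε with s-null _ (half-pos 0<ε) | t-null _ (half-pos 0<ε)
... | N₁ , s≤ | N₂ , t≤ = N₁ ℕ.⊔ N₂ , λ n N≤n → begin
    ∣ s n ℚ.+ t n ∣        ≤⟨ ℚ.∣p+q∣≤∣p∣+∣q∣ (s n) (t n) ⟩
    ∣ s n ∣ ℚ.+ ∣ t n ∣    ≤⟨ ℚ.+-mono-≤ (s≤ n (ℕ.m⊔n≤o⇒m≤o N₁ N₂ N≤n)) (t≤ n (ℕ.m⊔n≤o⇒n≤o N₁ N₂ N≤n)) ⟩
    ½ ℚ.* ε ℚ.+ ½ ℚ.* ε    ≡⟨ halves ε ⟩
    ε                      ∎
  where open ℚ.≤-Reasoning

divide : ∀ {K ε} → 0ℚ ℚ.< K → 0ℚ ℚ.< ε → Σ[ δ ∈ ℚ ] 0ℚ ℚ.< δ × K ℚ.* δ ≡ ε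
divide {K} {ε} 0<K 0<ε = 1/ K ℚ.* ε , 0<δ , Kδ≡ε
  where
  instance
    _ = ℚ.positive 0<K
    _ = ℚ.pos⇒nonZero K
    _ = ℚ.1/pos⇒pos K
  0<δ : 0ℚ ℚ.< 1/ K ℚ.* ε
  0<δ = subst (ℚ._< 1/ K ℚ.* ε) (ℚ.*-zeroʳ (1/ K)) (ℚ.*-monoʳ-<-pos (1/ K) 0<ε)
  Kδ≡ε : K ℚ.* (1/ K ℚ.* ε) ≡ ε
  Kδ≡ε = trans (sym (ℚ.*-assoc K (1/ K) ε))
           (trans (cong (ℚ._* ε) (ℚ.*-inverseʳ K)) (ℚ.*-identityˡ ε))

null-* : ∀ {s t} → Bounded s → Null t → Null (λ n → s n ℚ.* t n)
null-* {s} {t} (K , 0<K , N₁ , s≤) t-null ε 0<ε with divide 0<K 0<ε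
... | δ , 0<δ , Kδ≡ε with t-null δ 0<δ
... | N₂ , t≤ = N₁ ℕ.⊔ N₂ , λ n N≤n → begin
    ∣ s n ℚ.* t n ∣      ≡⟨ ℚ.∣p*q∣≡∣p∣*∣q∣ (s n) (t n) ⟩
    ∣ s n ∣ ℚ.* ∣ t n ∣  ≤⟨ ℚ.*-monoʳ-≤-nonNeg ∣ t n ∣ {{ℚ.∣-∣-nonNeg (t n)}} (s≤ n (ℕ.m⊔n≤o⇒m≤o N₁ N₂ N≤n)) ⟩
    K ℚ.* ∣ t n ∣        ≤⟨ ℚ.*-monoˡ-≤-nonNeg K {{ℚ.nonNegative (ℚ.<⇒≤ 0<K)}} (t≤ n (ℕ.m⊔n≤o⇒n≤o N₁ N₂ N≤n)) ⟩
    K ℚ.* δ              ≡⟨ Kδ≡ε ⟩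
    ε                    ∎
  where open ℚ.≤-Reasoning

cauchy-bounded : ∀ {s} → IsCauchy s → Bounded s
cauchy-bounded {s} s-cauchy with s-cauchy 1ℚ (ℚ.positive⁻¹ 1ℚ)
... | N , close = 1ℚ ℚ.+ ∣ s N ∣ , 0<K , N , λ n N≤n → begin
    ∣ s n ∣                        ≡⟨ cong ∣_∣ (shift (s n) (s N)) ⟨
    ∣ (s n ℚ.- s N) ℚ.+ s N ∣      ≤⟨ ℚ.∣p+q∣≤∣p∣+∣q∣ (s n ℚ.- s N) (s N) ⟩
    ∣ s n ℚ.- s N ∣ ℚ.+ ∣ s N ∣    ≤⟨ ℚ.+-monoˡ-≤ ∣ s N ∣ (close n N N≤n ℕ.≤-refl) ⟩
    1ℚ ℚ.+ ∣ s N ∣                 ∎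
  where
  open ℚ.≤-Reasoning
  shift : ∀ p q → (p ℚ.- q) ℚ.+ q ≡ p
  shift = solve 2 (λ p q → (p :- q) :+ q := p) refl where open +-*-Solver
  0<K : 0ℚ ℚ.< 1ℚ ℚ.+ ∣ s N ∣
  0<K = ℚ.+-mono-<-≤ (ℚ.positive⁻¹ 1ℚ) (ℚ.0≤∣p∣ (s N))

-- ℝ as an ordered commutative semiring

-- _≃_ unfolds to a statement about sequences, from which Agda cannot infer
-- the two real numbers; a record keeps them visible.
infix 4 _≈_

record _≈_ (x y : ℝ) : Set where
  constructor wrap
  field unwrap : x ≃ y

open _≈_

≗⇒≈ : ∀ {x y} → seq x ≗ seq y → x ≈ y
≗⇒≈ {x} {y} x≗y = wrap (null-resp-≗ (λ n → sym (trans (cong (ℚ._- seq y n) (x≗y n)) (ℚ.+-inverseʳ (seq y n)))) null-0)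

≈-isEquivalence : IsEquivalence _≈_
≈-isEquivalence = record
  { refl  = ≗⇒≈ (λ _ → refl)
  ; sym   = λ {x} {y} (wrap x≃y) → wrap (null-resp-≗ (λ n → flip-- (seq x n) (seq y n)) (null-neg x≃y))
  ; trans = λ {x} {y} {z} (wrap x≃y) (wrap y≃z) →
      wrap (null-resp-≗ (λ n → chain (seq x n) (seq y n) (seq z n)) (null-+ x≃y y≃z))
  }
  where
  open +-*-Solver
  flip-- : ∀ p q → ℚ.- (p ℚ.- q) ≡ q ℚ.- p
  flip-- = solve 2 (λ p q → :- (p :- q) := q :- p) refl
  chain : ∀ p q r → (p ℚ.- q) ℚ.+ (q ℚ.- r) ≡ p ℚ.- r
  chain = solve 3 (λ p q r → (p :- q) :+ (q :- r) := p :- r) refl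

+-cong : ∀ {x x′ y y′} → x ≈ x′ → y ≈ y′ → x + y ≈ x′ + y′
+-cong {x} {x′} {y} {y′} (wrap x≃x′) (wrap y≃y′) =
  wrap (null-resp-≗ (λ n → diff (seq x n) (seq x′ n) (seq y n) (seq y′ n)) (null-+ x≃x′ y≃y′))
  where
  open +-*-Solver
  diff : ∀ a b c d → (a ℚ.- b) ℚ.+ (c ℚ.- d) ≡ (a ℚ.+ c) ℚ.- (b ℚ.+ d)
  diff = solve 4 (λ a b c d → (a :- b) :+ (c :- d) := (a :+ c) :- (b :+ d)) refl

*-cong : ∀ {x x′ y y′} → x ≈ x′ → y ≈ y′ → x * y ≈ x′ * y′
*-cong {x} {x′} {y} {y′} (wrap x≃x′) (wrap y≃y′) =
  wrap (null-resp-≗ (λ n → diff (seq x n) (seq x′ n) (seq y n) (seq y′ n))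
    (null-+ {λ n → seq x n ℚ.* (seq y n ℚ.- seq y′ n)} {λ n → seq y′ n ℚ.* (seq x n ℚ.- seq x′ n)}
      (null-* {seq x} (cauchy-bounded (isCauchy x)) y≃y′)
      (null-* {seq y′} (cauchy-bounded (isCauchy y′)) x≃x′)))
  where
  open +-*-Solver
  diff : ∀ a b c d → a ℚ.* (c ℚ.- d) ℚ.+ d ℚ.* (a ℚ.- b) ≡ a ℚ.* c ℚ.- b ℚ.* d
  diff = solve 4 (λ a b c d → a :* (c :- d) :+ d :* (a :- b) := a :* c :- b :* d) refl

ℝ-commutativeSemiring : CommutativeSemiring 0ℓ 0ℓ
ℝ-commutativeSemiring = record
  { Carrier = ℝ ; _≈_ = _≈_ ; _+_ = _+_ ; _*_ = _*_ ; 0# = 0ℝ ; 1# = 1ℝ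
  ; isCommutativeSemiring = record
    { isSemiring = record
      { isSemiringWithoutAnnihilatingZero = record
        { +-isCommutativeMonoid = record
          { isMonoid = record
            { isSemigroup = record
              { isMagma = record { isEquivalence = ≈-isEquivalence ; ∙-cong = +-cong }
              ; assoc = λ x y z → ≗⇒≈ (λ n → ℚ.+-assoc (seq x n) (seq y n) (seq z n)) }
            ; identity = (λ x → ≗⇒≈ (λ n → ℚ.+-identityˡ (seq x n)))
                       , (λ x → ≗⇒≈ (λ n → ℚ.+-identityʳ (seq x n))) }
          ; comm = λ x y → ≗⇒≈ (λ n → ℚ.+-comm (seq x n) (seq y n)) }
        ; *-cong = *-cong
        ; *-assoc = λ x y z → ≗⇒≈ (λ n → ℚ.*-assoc (seq x n) (seq y n) (seq z n))
        ; *-identity = (λ x → ≗⇒≈ (λ n → ℚ.*-identityˡ (seq x n)))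
                     , (λ x → ≗⇒≈ (λ n → ℚ.*-identityʳ (seq x n)))
        ; distrib = (λ x y z → ≗⇒≈ (λ n → ℚ.*-distribˡ-+ (seq x n) (seq y n) (seq z n)))
                  , (λ x y z → ≗⇒≈ (λ n → ℚ.*-distribʳ-+ (seq x n) (seq y n) (seq z n))) }
      ; zero = (λ x → ≗⇒≈ (λ n → ℚ.*-zeroˡ (seq x n)))
             , (λ x → ≗⇒≈ (λ n → ℚ.*-zeroʳ (seq x n))) }
    ; *-comm = λ x y → ≗⇒≈ (λ n → ℚ.*-comm (seq x n) (seq y n)) } }

private
  module R = CommutativeSemiring ℝ-commutativeSemiring
  module RΣ = SemiringSum R.semiring
  module ℚΣ = SemiringSum (CommutativeRing.semiring ℚ.+-*-commutativeRing)
  module ℙΣ = SemiringSum ℙ.+-*-semiring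

≈⇒≤ : ∀ {x y} → x ≈ y → x ≤ y
≈⇒≤ {x} {y} (wrap x≃y) ε 0<ε with x≃y ε 0<ε
... | N , close = N , λ n N≤n → begin
    seq x n                            ≡⟨ shift (seq x n) (seq y n) ⟩
    seq y n ℚ.+ (seq x n ℚ.- seq y n)  ≤⟨ ℚ.+-monoʳ-≤ (seq y n) (p≤∣p∣ (seq x n ℚ.- seq y n)) ⟩
    seq y n ℚ.+ ∣ seq x n ℚ.- seq y n ∣ ≤⟨ ℚ.+-monoʳ-≤ (seq y n) (close n N≤n) ⟩
    seq y n ℚ.+ ε                      ∎
  where
  open ℚ.≤-Reasoning
  shift : ∀ p q → p ≡ q ℚ.+ (p ℚ.- q)
  shift = solve 2 (λ p q → p := q :+ (p :- q)) refl where open +-*-Solver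
  p≤∣p∣ : ∀ p → p ℚ.≤ ∣ p ∣
  p≤∣p∣ p with ℚ.≤-total 0ℚ p
  ... | inj₁ 0≤p = ℚ.≤-reflexive (sym (ℚ.0≤p⇒∣p∣≡p 0≤p))
  ... | inj₂ p≤0 = ℚ.≤-trans p≤0 (ℚ.0≤∣p∣ p)

≤-trans : ∀ x y z → x ≤ y → y ≤ z → x ≤ z
≤-trans x y z x≤y y≤z ε 0<ε with x≤y _ (half-pos 0<ε) | y≤z _ (half-pos 0<ε)
... | N₁ , x≤ | N₂ , y≤ = N₁ ℕ.⊔ N₂ , λ n N≤n → begin
    seq x n                                  ≤⟨ x≤ n (ℕ.m⊔n≤o⇒m≤o N₁ N₂ N≤n) ⟩
    seq y n ℚ.+ ½ ℚ.* ε                      ≤⟨ ℚ.+-monoˡ-≤ _ (y≤ n (ℕ.m⊔n≤o⇒n≤o N₁ N₂ N≤n)) ⟩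
    seq z n ℚ.+ ½ ℚ.* ε ℚ.+ ½ ℚ.* ε          ≡⟨ ℚ.+-assoc (seq z n) _ _ ⟩
    seq z n ℚ.+ (½ ℚ.* ε ℚ.+ ½ ℚ.* ε)        ≡⟨ cong (seq z n ℚ.+_) (halves ε) ⟩
    seq z n ℚ.+ ε                            ∎
  where open ℚ.≤-Reasoning

+-mono-≤ : ∀ {x x′ y y′} → x ≤ x′ → y ≤ y′ → x + y ≤ x′ + y′
+-mono-≤ {x} {x′} {y} {y′} x≤x′ y≤y′ ε 0<ε with x≤x′ _ (half-pos 0<ε) | y≤y′ _ (half-pos 0<ε)
... | N₁ , x≤ | N₂ , y≤ = N₁ ℕ.⊔ N₂ , λ n N≤n → begin
    seq x n ℚ.+ seq y n
      ≤⟨ ℚ.+-mono-≤ (x≤ n (ℕ.m⊔n≤o⇒m≤o N₁ N₂ N≤n)) (y≤ n (ℕ.m⊔n≤o⇒n≤o N₁ N₂ N≤n)) ⟩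
    (seq x′ n ℚ.+ ½ ℚ.* ε) ℚ.+ (seq y′ n ℚ.+ ½ ℚ.* ε)
      ≡⟨ regroup (seq x′ n) (½ ℚ.* ε) (seq y′ n) (½ ℚ.* ε) ⟩
    (seq x′ n ℚ.+ seq y′ n) ℚ.+ (½ ℚ.* ε ℚ.+ ½ ℚ.* ε)
      ≡⟨ cong (seq x′ n ℚ.+ seq y′ n ℚ.+_) (halves ε) ⟩
    (seq x′ n ℚ.+ seq y′ n) ℚ.+ ε  ∎
  where
  open ℚ.≤-Reasoning
  regroup : ∀ a b c d → (a ℚ.+ b) ℚ.+ (c ℚ.+ d) ≡ (a ℚ.+ c) ℚ.+ (b ℚ.+ d)
  regroup = solve 4 (λ a b c d → (a :+ b) :+ (c :+ d) := (a :+ c) :+ (b :+ d)) refl where open +-*-Solver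

sumℝ-mono-≤ : ∀ {k} {x y : Fin k → ℝ} → (∀ j → x j ≤ y j) → sumℝ x ≤ sumℝ y
sumℝ-mono-≤ {zero}          x≤y = ≈⇒≤ {0ℝ} R.refl
sumℝ-mono-≤ {suc k} {x} {y} x≤y =
  +-mono-≤ {x zero} {y zero} {sumℝ (x ∘ suc)} {sumℝ (y ∘ suc)} (x≤y zero)
    (sumℝ-mono-≤ {x = x ∘ suc} {y ∘ suc} (x≤y ∘ suc))

p≤q⇒0≤q-p : ∀ {p q} → p ℚ.≤ q → 0ℚ ℚ.≤ q ℚ.- p
p≤q⇒0≤q-p {p} {q} p≤q = subst (ℚ._≤ q ℚ.- p) (ℚ.+-inverseʳ p) (ℚ.+-monoˡ-≤ (ℚ.- p) p≤q)

*-monoˡ-≤-fromℚ : ∀ {w p q} → 0ℝ ≤ w → p ℚ.≤ q → w * fromℚ p ≤ w * fromℚ q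
-- The sequence of `w` is only eventually at least `- δ`, which costs `(q - p) δ`. Dividing `ε` by
-- `1 + (q - p)` keeps the divisor positive even when `p` equals `q`.
*-monoˡ-≤-fromℚ {w} {p} {q} 0≤w p≤q ε 0<ε with divide (ℚ.+-mono-<-≤ (ℚ.positive⁻¹ 1ℚ) (p≤q⇒0≤q-p p≤q)) 0<ε
... | δ , 0<δ , Kδ≡ε with 0≤w δ 0<δ
... | N , w≥ = N , λ n N≤n → begin
    seq w n ℚ.* p
      ≡⟨ expand (seq w n) p q δ ⟩
    (seq w n ℚ.* q ℚ.+ (q ℚ.- p) ℚ.* δ) ℚ.+ (q ℚ.- p) ℚ.* ℚ.- (seq w n ℚ.+ δ)
      ≤⟨ ℚ.+-monoʳ-≤ (seq w n ℚ.* q ℚ.+ (q ℚ.- p) ℚ.* δ)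
           (ℚ.*-monoˡ-≤-nonNeg (q ℚ.- p) {{ℚ.nonNegative (p≤q⇒0≤q-p p≤q)}} (ℚ.neg-antimono-≤ (w≥ n N≤n))) ⟩
    (seq w n ℚ.* q ℚ.+ (q ℚ.- p) ℚ.* δ) ℚ.+ (q ℚ.- p) ℚ.* 0ℚ
      ≡⟨ drop-zero (seq w n) p q δ ⟩
    seq w n ℚ.* q ℚ.+ (0ℚ ℚ.+ (q ℚ.- p) ℚ.* δ)
      ≤⟨ ℚ.+-monoʳ-≤ (seq w n ℚ.* q) (ℚ.+-monoˡ-≤ ((q ℚ.- p) ℚ.* δ) (ℚ.<⇒≤ 0<δ)) ⟩
    seq w n ℚ.* q ℚ.+ (δ ℚ.+ (q ℚ.- p) ℚ.* δ)
      ≡⟨ cong (seq w n ℚ.* q ℚ.+_) (trans (factor (q ℚ.- p) δ) Kδ≡ε) ⟩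
    seq w n ℚ.* q ℚ.+ ε
      ∎
  where
  open ℚ.≤-Reasoning
  open +-*-Solver
  expand : ∀ w p q δ → w ℚ.* p ≡ (w ℚ.* q ℚ.+ (q ℚ.- p) ℚ.* δ) ℚ.+ (q ℚ.- p) ℚ.* ℚ.- (w ℚ.+ δ)
  expand = solve 4 (λ w p q δ → w :* p := (w :* q :+ (q :- p) :* δ) :+ (q :- p) :* :- (w :+ δ)) refl
  drop-zero : ∀ w p q δ → (w ℚ.* q ℚ.+ (q ℚ.- p) ℚ.* δ) ℚ.+ (q ℚ.- p) ℚ.* 0ℚ ≡ w ℚ.* q ℚ.+ (0ℚ ℚ.+ (q ℚ.- p) ℚ.* δ)
  drop-zero = solve 4 (λ w p q δ → (w :* q :+ (q :- p) :* δ) :+ (q :- p) :* con 0ℚ := w :* q :+ (con 0ℚ :+ (q :- p) :* δ)) refl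
  factor : ∀ p δ → δ ℚ.+ p ℚ.* δ ≡ (1ℚ ℚ.+ p) ℚ.* δ
  factor = solve 2 (λ p δ → δ :+ p :* δ := (con 1ℚ :+ p) :* δ) refl

-- If `q < p`, the tolerance of half the gap already refutes the real inequality.
fromℚ-cancel-≤ : ∀ {p q} → fromℚ p ≤ fromℚ q → p ℚ.≤ q
fromℚ-cancel-≤ {p} {q} p≤q = ℚ.≮⇒≥ λ q<p →
  let 0<p-q = subst (ℚ._< p ℚ.- q) (ℚ.+-inverseʳ q) (ℚ.+-monoˡ-< (ℚ.- q) q<p)
      N , bound = p≤q (½ ℚ.* (p ℚ.- q)) (half-pos 0<p-q)
  in ℚ.<-irrefl refl (ℚ.<-≤-trans (middle q<p) (bound N ℕ.≤-refl))
  where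
  open +-*-Solver
  middle : q ℚ.< p → q ℚ.+ ½ ℚ.* (p ℚ.- q) ℚ.< p
  middle q<p = subst₂ ℚ._<_ (lower p q) (halves p)
    (ℚ.+-monoʳ-< (½ ℚ.* p) (ℚ.*-monoʳ-<-pos ½ q<p))
    where
    lower : ∀ p q → ½ ℚ.* p ℚ.+ ½ ℚ.* q ≡ q ℚ.+ ½ ℚ.* (p ℚ.- q)
    lower = solve 2 (λ p q → con ½ :* p :+ con ½ :* q := q :+ con ½ :* (p :- q)) refl

-- Subsets and bases

∈─⇒∉ : ∀ (S T : Subset n) → i ∈ S ─ T → i ∉ T
∈─⇒∉ (_ ∷ S) (Subset.inside  ∷ T) (there i∈) (there i∈T) = ∈─⇒∉ S T i∈ i∈T
∈─⇒∉ (_ ∷ S) (Subset.outside ∷ T) (there i∈) (there i∈T) = ∈─⇒∉ S T i∈ i∈T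

swap : Subset n → Fin n → Fin n → Subset n
swap S x y = (S - x) ∪ ⁅ y ⁆

∈-swap⁻ : i ∈ swap S x y → (i ∈ S × i ≢ x) ⊎ i ≡ y
∈-swap⁻ {S = S} {x = x} {y = y} i∈ with x∈p∪q⁻ (S - x) ⁅ y ⁆ i∈
... | inj₁ i∈S-x = inj₁ (p─q⊆p S ⁅ x ⁆ i∈S-x , λ { refl → ∈─⇒∉ S ⁅ x ⁆ i∈S-x (x∈⁅x⁆ x) })
... | inj₂ i∈y   = inj₂ (x∈⁅y⁆⇒x≡y y i∈y)

∈-swap⁺ˡ : i ∈ S → i ≢ x → i ∈ swap S x y
∈-swap⁺ˡ i∈S i≢x = x∈p∪q⁺ (inj₁ (x∈p∧x≢y⇒x∈p-y i∈S i≢x))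

∈-swap⁺ʳ : y ∈ swap S x y
∈-swap⁺ʳ = x∈p∪q⁺ (inj₂ (x∈⁅x⁆ _))

∉-swap : x ≢ y → x ∉ swap S x y
∉-swap x≢y x∈ with ∈-swap⁻ x∈
... | inj₁ (_ , x≢x) = x≢x refl
... | inj₂ x≡y       = x≢y x≡y

difference? : ∀ (S T : Subset n) → Dec (Σ[ i ∈ Fin n ] i ∈ S × i ∉ T)
difference? S T = Fin.any? (λ i → (i ∈? S) ×-dec ¬? (i ∈? T))

no-difference⇒⊆ : ¬ (Σ[ i ∈ Fin n ] i ∈ S × i ∉ T) → S ⊆ T
no-difference⇒⊆ {T = T} none {i} i∈S = decidable-stable (i ∈? T) (λ i∉T → none (i , i∈S , i∉T))

module _ (M : Matroid n) where

  -- An element of `T` outside `S` would have to be exchanged for one of `S` outside `T`, and there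
  -- is none.
  base-maximal : Base M S → Base M T → S ⊆ T → T ≡ S
  base-maximal {S} {T} bS bT S⊆T = ⊆-antisym (no-difference⇒⊆ excess) S⊆T
    where
    excess : ¬ (Σ[ i ∈ Fin n ] i ∈ T × i ∉ S)
    excess (i , i∈T , i∉S) with exchange M bT bS i∈T i∉S
    ... | y , y∈S , y∉T , _ = y∉T (S⊆T y∈S)

  -- Exchange elements of A ─ C other than a into C until only a is left outside C.
  dual-exchange : Base M A → Base M C → ∀ {a} → a ∈ A → a ∉ C →
                  Σ[ c ∈ Fin n ] c ∈ C × c ∉ A × Base M (swap C c a)
  dual-exchange {A} {C} bA bC {a} a∈A a∉C = reduce A (<-wellFounded _) bA a∈A (λ i∈A _ → i∈A)
    where
    reduce : ∀ X → Acc ℕ._<_ Subset.∣ X ─ C ∣ → Base M X → a ∈ X → (∀ {i} → i ∈ A → i ∈ C → i ∈ X) →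
             Σ[ c ∈ Fin n ] c ∈ C × c ∉ A × Base M (swap C c a)
    reduce X (acc rec) bX a∈X A∩C⊆X
      with Fin.any? (λ i → (i ∈? X) ×-dec ¬? (i ∈? C) ×-dec ¬? (i Fin.≟ a))
    ... | yes (x , x∈X , x∉C , x≢a) with exchange M bX bC x∈X x∉C
    ...   | y , y∈C , y∉X , bX′ =
            reduce (swap X x y) (rec (p⊂q⇒∣p∣<∣q∣ (smaller , x , x∈p∧x∉q⇒x∈p─q x∈X x∉C , x-removed)))
              bX′ (∈-swap⁺ˡ a∈X (x≢a ∘ sym))
              (λ i∈A i∈C → ∈-swap⁺ˡ (A∩C⊆X i∈A i∈C) λ { refl → x∉C i∈C })
      where
      smaller : swap X x y ─ C ⊆ X ─ C
      smaller i∈ with ∈-swap⁻ (p─q⊆p (swap X x y) C i∈)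
      ... | inj₁ (i∈X , _) = x∈p∧x∉q⇒x∈p─q i∈X (∈─⇒∉ (swap X x y) C i∈)
      ... | inj₂ refl      = contradiction y∈C (∈─⇒∉ (swap X x y) C i∈)
      x-removed : x ∉ swap X x y ─ C
      x-removed x∈ = ∉-swap (λ { refl → y∉X x∈X }) (p─q⊆p (swap X x y) C x∈)
    reduce X _ bX a∈X A∩C⊆X | no X⊆C∪a with difference? C X
    ... | no C⊆X = contradiction (subst (a ∈_) (base-maximal bC bX (no-difference⇒⊆ C⊆X)) a∈X) a∉C
    -- Now `a` is the only element of `X` outside `C`, so it is what replaces `c`. As `X` still
    -- contains `A ∩ C`, the element `c` is not in `A`.
    ... | yes (c , c∈C , c∉X) with exchange M bC bX c∈C c∉X
    ...   | y , y∈X , y∉C , bC′ with y Fin.≟ a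
    ...     | yes refl = c , c∈C , (λ c∈A → c∉X (A∩C⊆X c∈A c∈C)) , bC′
    ...     | no y≢a   = contradiction (y , y∈X , y∉C , y≢a) X⊆C∪a

-- Fundamental relations among columns over 𝔽₂.

≢1ℙ⇒≡0ℙ : ∀ {p} → p ≢ 1ℙ → p ≡ 0ℙ
≢1ℙ⇒≡0ℙ {0ℙ} _   = refl
≢1ℙ⇒≡0ℙ {1ℙ} p≢1 = contradiction refl p≢1

≢0ℙ⇒≡1ℙ : ∀ {p} → p ≢ 0ℙ → p ≡ 1ℙ
≢0ℙ⇒≡1ℙ {1ℙ} _   = refl
≢0ℙ⇒≡1ℙ {0ℙ} p≢0 = contradiction refl p≢0

module _ (M : Matroid n) {m} (D : Fin m → Fin n → Parity)
         (represents : ∀ S → (Independent M S → ColumnsIndependent D S) × (ColumnsIndependent D S → Independent M S)) where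

  Relation : (Fin n → Parity) → Set
  Relation κ = ∀ r → sumℙ (λ i → κ i ℙ.* D r i) ≡ 0ℙ

  -- For a base `C` and `a ∉ C`, the support of `κ` is the fundamental circuit of `a` with respect
  -- to `C`.
  FundamentalRelation : Subset n → Fin n → (Fin n → Parity) → Set
  FundamentalRelation C a κ = (∀ i → i ∉ C → i ≢ a → κ i ≡ 0ℙ) × Relation κ × κ a ≡ 1ℙ

  base⇒independent : Base M S → ColumnsIndependent D S
  base⇒independent {S} bS = proj₁ (represents S) (S , bS , id)

  -- Without such a relation `C ∪ ⁅ a ⁆` would be independent, hence contained in a base properly
  -- larger than `C`. Only the absence of a relation is refuted, so the existence is doubly negated.
  fundamentalRelation : ∀ {a} → Base M C → a ∉ C → ¬ ¬ ∃ (FundamentalRelation C a)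
  fundamentalRelation {C} {a} bC a∉C none = a∉C (subst (a ∈_) (base-maximal M bC bB C⊆B) a∈B)
    where
    independent : Independent M (C ∪ ⁅ a ⁆)
    independent = proj₂ (represents (C ∪ ⁅ a ⁆)) λ κ support relation →
      let outside i i∉C i≢a = support i
            (λ i∈ → [ i∉C , i≢a ∘ x∈⁅y⁆⇒x≡y a ]′ (x∈p∪q⁻ C ⁅ a ⁆ i∈))
          -- A relation on `C ∪ ⁅ a ⁆` with coefficient 1 at `a` would be fundamental. With
          -- coefficient 0 it lives on the independent set `C`.
          κa≡0 = ≢1ℙ⇒≡0ℙ (λ κa≡1 → none (κ , outside , relation , κa≡1))
          supportC i i∉C = decidable-stable (κ i ℙ.≟ 0ℙ)
            (λ κi≢0 → κi≢0 (outside i i∉C λ { refl → κi≢0 κa≡0 }))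
      in base⇒independent bC κ supportC relation
    bB = proj₁ (proj₂ independent)
    C⊆B : C ⊆ proj₁ independent
    C⊆B = proj₂ (proj₂ independent) ∘ p⊆p∪q ⁅ a ⁆
    a∈B : a ∈ proj₁ independent
    a∈B = proj₂ (proj₂ independent) (q⊆p∪q C ⁅ a ⁆ (x∈⁅x⁆ a))

  -- If `κ c` were 0, then `κ` would be a relation supported on the base `swap C c a`, yet it is 1
  -- at `a`.
  fundamentalRelation-swap : ∀ {a c κ} → FundamentalRelation C a κ → Base M (swap C c a) → κ c ≡ 1ℙ
  fundamentalRelation-swap {C} {a} {c} {κ} (outside , relation , κa≡1) bX = ≢0ℙ⇒≡1ℙ λ κc≡0 →
    let support i i∉X = decidable-stable (κ i ℙ.≟ 0ℙ)
          (λ κi≢0 → κi≢0 (outside i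
            (λ i∈C → i∉X (∈-swap⁺ˡ i∈C λ { refl → κi≢0 κc≡0 }))
            (λ { refl → i∉X ∈-swap⁺ʳ })))
    in contradiction (trans (sym κa≡1) (base⇒independent bX κ support relation a)) λ ()

  relation-+ : ∀ {κ μ} → Relation κ → Relation μ → Relation (λ i → κ i ℙ.+ μ i)
  relation-+ {κ} {μ} rκ rμ r = begin
    sumℙ (λ i → (κ i ℙ.+ μ i) ℙ.* D r i)
      ≡⟨ ℙΣ.sum-cong-≗ (λ i → ℙ.*-distribʳ-+ (D r i) (κ i) (μ i)) ⟩
    sumℙ (λ i → (κ i ℙ.* D r i) ℙ.+ (μ i ℙ.* D r i))
      ≡⟨ ℙΣ.∑-distrib-+ (λ i → κ i ℙ.* D r i) (λ i → μ i ℙ.* D r i) ⟩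
    sumℙ (λ i → κ i ℙ.* D r i) ℙ.+ sumℙ (λ i → μ i ℙ.* D r i)
      ≡⟨ cong₂ ℙ._+_ (rκ r) (rμ r) ⟩
    0ℙ ∎
    where open ≡-Reasoning

  -- Over 𝔽₂ both fundamental relations have coefficient 1 on all of C ─ A,
  -- so their sum is a nontrivial relation within A.
  not-all-swaps : ∀ {a b} → Base M A → Base M C → a ∈ A → a ∉ C → b ∈ A → b ∉ C → a ≢ b →
    ¬ (∀ {c d} → c ∈ C → c ∉ A → d ∈ A → d ∉ C → Base M (swap C c d))
  not-all-swaps {A} {C} {a} {b} bA bC a∈A a∉C b∈A b∉C a≢b all =
    fundamentalRelation bC a∉C λ (κ , Fκ) → fundamentalRelation bC b∉C λ (μ , Fμ) →
      -- At `a` the sum is 1 + 0, because `a` is neither in `C` nor equal to `b`.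
      contradiction (trans (sym (cong₂ ℙ._+_ (proj₂ (proj₂ Fκ)) (proj₁ Fμ a a∉C a≢b)))
                           (sum-zero Fκ Fμ a)) λ ()
    where
    sum-zero : ∀ {κ μ} → FundamentalRelation C a κ → FundamentalRelation C b μ → ∀ i → κ i ℙ.+ μ i ≡ 0ℙ
    sum-zero {κ} {μ} Fκ@(κ-outside , κ-relation , _) Fμ@(μ-outside , μ-relation , _) =
      base⇒independent bA (λ i → κ i ℙ.+ μ i) support (relation-+ κ-relation μ-relation)
      where
      support : ∀ i → i ∉ A → κ i ℙ.+ μ i ≡ 0ℙ
      support i i∉A with i ∈? C
      ... | yes i∈C = cong₂ ℙ._+_ (fundamentalRelation-swap Fκ (all i∈C i∉A a∈A a∉C))
                                  (fundamentalRelation-swap Fμ (all i∈C i∉A b∈A b∉C))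
      ... | no i∉C  = cong₂ ℙ._+_ (κ-outside i i∉C λ { refl → i∉A a∈A }) (μ-outside i i∉C λ { refl → i∉A b∈A })

-- Descent on pairs of bases separated by the two subpolytopes.

module Separation (M N₁ N₂ : Matroid n) (M-binary : Binary M) (N₁? : Decidable (Base N₁))
  (N₁⊆M : ∀ {S} → Base N₁ S → Base M S) (N₂⊆M : ∀ {S} → Base N₂ S → Base M S)
  (cover : ∀ {S} → Base M S → Base N₁ S ⊎ Base N₂ S)
  -- This is how edges of the polytope enter: `A` and `C` differ by one exchange, and a subpolytope
  -- containing their midpoint has both ends as bases.
  (edge : ∀ {A C a c} → Base N₁ A → Base N₂ C →
     (∀ {i} → i ∈ A → i ∉ C → i ≡ a) → (∀ {i} → i ∈ C → i ∉ A → i ≡ c) →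
     a ∉ C → c ∉ A → Base N₂ A ⊎ Base N₁ C)
  where

  -- Induction on the size of `A ─ C` with `A` fixed. Size 0 forces `A` and `C` to coincide, size 1
  -- contradicts `edge`, and a larger size contradicts `not-all-swaps`.
  not-separated : ∀ A C → Acc ℕ._<_ Subset.∣ A ─ C ∣ →
    Base N₁ A → ¬ Base N₂ A → Base N₂ C → ¬ Base N₁ C → ⊥
  not-separated A C (acc rec) A∈N₁ A∉N₂ C∈N₂ C∉N₁ with difference? A C
  ... | no A⊆C = C∉N₁ (subst (Base N₁) (sym (base-maximal M (N₁⊆M A∈N₁) (N₂⊆M C∈N₂) (no-difference⇒⊆ A⊆C))) A∈N₁)
  ... | yes (a , a∈A , a∉C) with Fin.any? (λ i → (i ∈? A) ×-dec ¬? (i ∈? C) ×-dec ¬? (i Fin.≟ a))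
  -- The exchanged base `swap A a c` lies inside `C`, hence equals it. So `c` is the only element of
  -- `C ─ A`, and `edge` applies.
  ...   | no unique with exchange M (N₁⊆M A∈N₁) (N₂⊆M C∈N₂) a∈A a∉C
  ...     | c , c∈C , c∉A , bX = [ A∉N₂ , C∉N₁ ]′ (edge A∈N₁ C∈N₂ A─C C─A a∉C c∉A)
    where
    A─C : ∀ {i} → i ∈ A → i ∉ C → i ≡ a
    A─C {i} i∈A i∉C = decidable-stable (i Fin.≟ a) (λ i≢a → unique (i , i∈A , i∉C , i≢a))
    X⊆C : swap A a c ⊆ C
    X⊆C {i} i∈ with ∈-swap⁻ i∈
    ... | inj₁ (i∈A , i≢a) = decidable-stable (i ∈? C) (i≢a ∘ A─C i∈A)
    ... | inj₂ refl        = c∈C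
    C─A : ∀ {i} → i ∈ C → i ∉ A → i ≡ c
    C─A i∈C i∉A with ∈-swap⁻ (subst (_ ∈_) (base-maximal M bX (N₂⊆M C∈N₂) X⊆C) i∈C)
    ... | inj₁ (i∈A , _) = contradiction i∈A i∉A
    ... | inj₂ i≡c       = i≡c
  not-separated A C (acc rec) A∈N₁ A∉N₂ C∈N₂ C∉N₁ | yes (a , a∈A , a∉C) | yes (b , b∈A , b∉C , b≢a) =
    not-all-swaps M (proj₁ (proj₂ M-binary))
      (λ S → let open Equivalence (proj₂ (proj₂ M-binary) S) in to , from)
      (N₁⊆M A∈N₁) (N₂⊆M C∈N₂) a∈A a∉C b∈A b∉C (b≢a ∘ sym) (λ c∈C c∉A d∈A d∉C → N₁⊆M (all-swaps c∈C c∉A d∈A d∉C))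
    where
    -- Otherwise `cover` makes the swap a base of `N₂` alone. It contains `d`, so it is closer to
    -- `A` than `C` is, and the induction hypothesis refutes it.
    swap∈N₁ : ∀ {c d} → c ∈ C → c ∉ A → d ∈ A → d ∉ C → Base M (swap C c d) → Base N₁ (swap C c d)
    swap∈N₁ {c} {d} c∈C c∉A d∈A d∉C bX = decidable-stable (N₁? (swap C c d)) λ X∉N₁ →
      not-separated A (swap C c d)
        (rec (p⊂q⇒∣p∣<∣q∣ (closer , d , x∈p∧x∉q⇒x∈p─q d∈A d∉C , λ d∈ → ∈─⇒∉ A (swap C c d) d∈ ∈-swap⁺ʳ)))
        A∈N₁ A∉N₂ ([ (λ X∈N₁ → contradiction X∈N₁ X∉N₁) , id ]′ (cover bX)) X∉N₁
      where
      closer : A ─ swap C c d ⊆ A ─ C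
      closer i∈ = x∈p∧x∉q⇒x∈p─q i∈A (λ i∈C → ∈─⇒∉ A (swap C c d) i∈ (∈-swap⁺ˡ i∈C λ { refl → c∉A i∈A }))
        where i∈A = p─q⊆p A (swap C c d) i∈
    -- Exchange in `M` pairs `c` with some `d′`, and dual exchange pairs `d` with some `c′`. If
    -- neither gives the wanted pair, both swaps are bases of `N₁`, and exchanging `d′` between them
    -- brings in `d` or `c`. The element `c` would restore `C`, which is not a base of `N₁`.
    all-swaps : ∀ {c d} → c ∈ C → c ∉ A → d ∈ A → d ∉ C → Base N₁ (swap C c d)
    all-swaps {c} {d} c∈C c∉A d∈A d∉C
      with exchange M (N₂⊆M C∈N₂) (N₁⊆M A∈N₁) c∈C c∉A | dual-exchange M (N₁⊆M A∈N₁) (N₂⊆M C∈N₂) d∈A d∉C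
    ... | d′ , d′∈A , d′∉C , bX | c′ , c′∈C , c′∉A , bY with d′ Fin.≟ d | c′ Fin.≟ c
    ... | yes refl | _        = swap∈N₁ c∈C c∉A d∈A d∉C bX
    ... | no _     | yes refl = swap∈N₁ c∈C c∉A d∈A d∉C bY
    ... | no d′≢d  | no c′≢c  with exchange N₁ (swap∈N₁ c∈C c∉A d′∈A d′∉C bX) (swap∈N₁ c′∈C c′∉A d∈A d∉C bY)
                                 ∈-swap⁺ʳ d′∉Y
      where
      d′∉Y : d′ ∉ swap C c′ d
      d′∉Y d′∈ = [ (λ (d′∈C , _) → d′∉C d′∈C) , d′≢d ]′ (∈-swap⁻ d′∈)
    ... | y , y∈Y , y∉X , bZ with ∈-swap⁻ y∈Y
    ... | inj₂ refl = subst (Base N₁) (⊆-antisym Z⊆ ⊆Z) bZ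
      where
      Z⊆ : swap (swap C c d′) d′ d ⊆ swap C c d
      Z⊆ i∈ with ∈-swap⁻ i∈
      ... | inj₂ refl = ∈-swap⁺ʳ
      ... | inj₁ (i∈X , i≢d′) with ∈-swap⁻ i∈X
      ...   | inj₁ (i∈C , i≢c) = ∈-swap⁺ˡ i∈C i≢c
      ...   | inj₂ i≡d′        = contradiction i≡d′ i≢d′
      ⊆Z : swap C c d ⊆ swap (swap C c d′) d′ d
      ⊆Z i∈ with ∈-swap⁻ i∈
      ... | inj₁ (i∈C , i≢c) = ∈-swap⁺ˡ (∈-swap⁺ˡ i∈C i≢c) (λ { refl → d′∉C i∈C })
      ... | inj₂ refl        = ∈-swap⁺ʳ
    ... | inj₁ (y∈C , _) = contradiction (subst (Base N₁) (⊆-antisym Z⊆C C⊆Z) bZ) C∉N₁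
      where
      y≡c : y ≡ c
      y≡c = decidable-stable (y Fin.≟ c) (λ y≢c → y∉X (∈-swap⁺ˡ y∈C y≢c))
      Z⊆C : swap (swap C c d′) d′ y ⊆ C
      Z⊆C i∈ with ∈-swap⁻ i∈
      ... | inj₂ refl = y∈C
      ... | inj₁ (i∈X , i≢d′) with ∈-swap⁻ i∈X
      ...   | inj₁ (i∈C , _) = i∈C
      ...   | inj₂ i≡d′      = contradiction i≡d′ i≢d′
      C⊆Z : C ⊆ swap (swap C c d′) d′ y
      C⊆Z {i} i∈C with i Fin.≟ c
      ... | yes refl = subst (_∈ swap (swap C c d′) d′ y) y≡c ∈-swap⁺ʳ
      ... | no i≢c   = ∈-swap⁺ˡ (∈-swap⁺ˡ i∈C i≢c) (λ { refl → d′∉C i∈C })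

-- Linear functionals on base polytopes

·-conv : ∀ {k} (c : Point n) (v : Fin k → Point n) (w : Fin k → ℝ) →
         c · (λ i → sumℝ (λ j → w j * v j i)) ≈ sumℝ (λ j → w j * (c · v j))
·-conv c v w = begin
  sumℝ (λ i → c i * sumℝ (λ j → w j * v j i))    ≈⟨ RΣ.sum-cong-≋ (λ i → RΣ.*-distribˡ-sum (c i) (λ j → w j * v j i)) ⟩
  sumℝ (λ i → sumℝ (λ j → c i * (w j * v j i)))  ≈⟨ RΣ.∑-comm (λ i j → c i * (w j * v j i)) ⟩
  sumℝ (λ j → sumℝ (λ i → c i * (w j * v j i)))
    ≈⟨ RΣ.sum-cong-≋ (λ j → RΣ.sum-cong-≋ (λ i → exchange-factors (c i) (w j) (v j i))) ⟩
  sumℝ (λ j → sumℝ (λ i → w j * (c i * v j i)))  ≈⟨ RΣ.sum-cong-≋ (λ j → RΣ.*-distribˡ-sum (w j) (λ i → c i * v j i)) ⟨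
  sumℝ (λ j → w j * sumℝ (λ i → c i * v j i))    ∎
  where
  open SetoidReasoning R.setoid
  exchange-factors : ∀ a b d → a * (b * d) ≈ b * (a * d)
  exchange-factors a b d = R.trans (R.sym (R.*-assoc a b d)) (R.trans (R.*-congʳ (R.*-comm a b)) (R.*-assoc b a d))

sumℚ : (Fin n → ℚ) → ℚ
sumℚ = ℚΣ.sum

fromℚ-sum : (f : Fin n → ℚ) → sumℝ (fromℚ ∘ f) ≈ fromℚ (sumℚ f)
fromℚ-sum {zero}  f = R.refl
fromℚ-sum {suc n} f = R.trans (R.+-congˡ (fromℚ-sum (f ∘ suc))) (≗⇒≈ (λ _ → refl))

indicator : Bool → ℚ
indicator s = if s then 1ℚ else 0ℚ

incidence-indicator : ∀ (S : Subset n) i → incidence S i ≈ fromℚ (indicator (lookup S i))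
incidence-indicator S i with lookup S i
... | true  = R.refl
... | false = R.refl

-- The value at the vertex of `S` of the functional with coefficients `u`. Rational coefficients let
-- values at vertices be compared in `ℚ`.
weight : (Fin n → ℚ) → Subset n → ℚ
weight u S = sumℚ (λ i → u i ℚ.* indicator (lookup S i))

·-incidence : ∀ (u : Fin n → ℚ) v S → v ≃ᵛ incidence S → (fromℚ ∘ u) · v ≈ fromℚ (weight u S)
·-incidence u v S v≃S = R.trans
  (RΣ.sum-cong-≋ (λ i → R.trans (R.*-congˡ {fromℚ (u i)} (R.trans (wrap (v≃S i)) (incidence-indicator S i)))
                                (≗⇒≈ (λ _ → refl))))
  (fromℚ-sum (λ i → u i ℚ.* indicator (lookup S i)))

-- By linearity the value at `x` is a mean of values at bases, with nonnegative weights of sum 1.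
weight-bound : ∀ (N : Matroid n) (u : Fin n → ℚ) q → (∀ S → Base N S → weight u S ℚ.≤ q) →
               ∀ x → P N x → (fromℚ ∘ u) · x ≤ fromℚ q
weight-bound N u q bound x (k , v , w , v∈ , 0≤w , Σw≃1 , x≃) =
  ≤-trans ((fromℚ ∘ u) · x) (sumℝ (λ j → w j * fromℚ (weight u (B j)))) (fromℚ q) (≈⇒≤ x≈)
    (≤-trans (sumℝ (λ j → w j * fromℚ (weight u (B j)))) (sumℝ (λ j → w j * fromℚ q)) (fromℚ q)
      (sumℝ-mono-≤ termwise) (≈⇒≤ total))
  where
  open SetoidReasoning R.setoid
  B : Fin k → Subset _
  B j = proj₁ (v∈ j)
  x≈ : (fromℚ ∘ u) · x ≈ sumℝ (λ j → w j * fromℚ (weight u (B j)))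
  x≈ = begin
    (fromℚ ∘ u) · x                                        ≈⟨ RΣ.sum-cong-≋ (λ i → R.*-congˡ (wrap (x≃ i))) ⟩
    (fromℚ ∘ u) · (λ i → sumℝ (λ j → w j * v j i))         ≈⟨ ·-conv (fromℚ ∘ u) v w ⟩
    sumℝ (λ j → w j * ((fromℚ ∘ u) · v j))
      ≈⟨ RΣ.sum-cong-≋ (λ j → R.*-congˡ (·-incidence u (v j) (B j) (proj₂ (proj₂ (v∈ j))))) ⟩
    sumℝ (λ j → w j * fromℚ (weight u (B j)))              ∎
  termwise : ∀ j → w j * fromℚ (weight u (B j)) ≤ w j * fromℚ q
  termwise j = *-monoˡ-≤-fromℚ {w j} (0≤w j) (bound (B j) (proj₁ (proj₂ (v∈ j))))
  total : sumℝ (λ j → w j * fromℚ q) ≈ fromℚ q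
  total = begin
    sumℝ (λ j → w j * fromℚ q)  ≈⟨ RΣ.*-distribʳ-sum (fromℚ q) w ⟨
    sumℝ w * fromℚ q            ≈⟨ R.*-congʳ (wrap Σw≃1) ⟩
    1ℝ * fromℚ q                ≈⟨ R.*-identityˡ (fromℚ q) ⟩
    fromℚ q                     ∎

-- Midpoints of pairs of bases.

pair : Subset n → Subset n → Fin 2 → Subset n
pair A C zero    = A
pair A C (suc _) = C

-- Written in the shape that `conv` asks for. `midpoint S S` serves as the vertex of `S`.
midpoint : Subset n → Subset n → Point n
midpoint A C i = sumℝ (λ j → fromℚ ½ * incidence (pair A C j) i)

midpoint∈P : ∀ (M : Matroid n) A C → Base M A → Base M C → P M (midpoint A C)
midpoint∈P M A C bA bC = 2 , incidence ∘ pair A C , (λ _ → fromℚ ½) , vertices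
  , (λ _ _ 0<ε → 0 , λ _ _ → ℚ.+-mono-≤ (from-yes (0ℚ ℚ.≤? ½)) (ℚ.<⇒≤ 0<ε))
  , unwrap (≗⇒≈ {sumℝ {2} (λ _ → fromℚ ½)} {1ℝ} (λ _ → refl))
  , (λ i → unwrap (R.refl {midpoint A C i}))
  where
  vertices : ∀ j → Σ[ B ∈ Subset _ ] Base M B × incidence (pair A C j) ≃ᵛ incidence B
  vertices zero       = A , bA , λ i → unwrap (R.refl {incidence A i})
  vertices (suc zero) = C , bC , λ i → unwrap (R.refl {incidence C i})

·-midpoint : ∀ (u : Fin n → ℚ) A C → (fromℚ ∘ u) · midpoint A C ≈ fromℚ (½ ℚ.* weight u A ℚ.+ ½ ℚ.* weight u C)
·-midpoint u A C = begin
  (fromℚ ∘ u) · midpoint A C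
    ≈⟨ ·-conv (fromℚ ∘ u) (incidence ∘ pair A C) (λ _ → fromℚ ½) ⟩
  sumℝ (λ j → fromℚ ½ * ((fromℚ ∘ u) · incidence (pair A C j)))
    ≈⟨ RΣ.sum-cong-≋ (λ j → R.*-congˡ {fromℚ ½} (·-incidence u (incidence (pair A C j)) (pair A C j) (λ i → unwrap (R.refl {incidence (pair A C j) i})))) ⟩
  sumℝ (λ j → fromℚ ½ * fromℚ (weight u (pair A C j)))
    ≈⟨ ≗⇒≈ (λ _ → cong (½ ℚ.* weight u A ℚ.+_) (ℚ.+-identityʳ (½ ℚ.* weight u C))) ⟩
  fromℚ (½ ℚ.* weight u A ℚ.+ ½ ℚ.* weight u C) ∎
  where open SetoidReasoning R.setoid

sumℚ-mono-≤ : (f g : Fin n → ℚ) → (∀ i → f i ℚ.≤ g i) → sumℚ f ℚ.≤ sumℚ g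
sumℚ-mono-≤ {zero}  f g f≤g = ℚ.≤-refl
sumℚ-mono-≤ {suc n} f g f≤g = ℚ.+-mono-≤ (f≤g zero) (sumℚ-mono-≤ (f ∘ suc) (g ∘ suc) (f≤g ∘ suc))

-- The shift `q` may have either sign: 1 records a guaranteed gain, `-1ℚ` a bounded loss.
sumℚ-mono-≤-at : (f g : Fin n → ℚ) (q : ℚ) (i : Fin n) → f i ℚ.+ q ℚ.≤ g i → (∀ j → j ≢ i → f j ℚ.≤ g j) →
                 sumℚ f ℚ.+ q ℚ.≤ sumℚ g
sumℚ-mono-≤-at f g q zero at-i elsewhere =
  subst (ℚ._≤ sumℚ g) (regroup (f zero) (sumℚ (f ∘ suc)) q)
    (ℚ.+-mono-≤ at-i (sumℚ-mono-≤ (f ∘ suc) (g ∘ suc) (λ j → elsewhere (suc j) λ ())))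
  where
  regroup : ∀ a b c → (a ℚ.+ c) ℚ.+ b ≡ (a ℚ.+ b) ℚ.+ c
  regroup = solve 3 (λ a b c → (a :+ c) :+ b := (a :+ b) :+ c) refl where open +-*-Solver
sumℚ-mono-≤-at f g q (suc i) at-i elsewhere =
  subst (ℚ._≤ sumℚ g) (sym (ℚ.+-assoc (f zero) (sumℚ (f ∘ suc)) q))
    (ℚ.+-mono-≤ (elsewhere zero λ ())
      (sumℚ-mono-≤-at (f ∘ suc) (g ∘ suc) q i at-i (λ j j≢i → elsewhere (suc j) (j≢i ∘ Fin.suc-injective))))

-- Sign functionals that measure agreement with a subset.

-1ℚ : ℚ
-1ℚ = ℚ.- 1ℚ

sign : Bool → Bool → ℚ
sign t z = if t then 0ℚ else (if z then 1ℚ else -1ℚ)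

-- The weight of `S` under these coefficients is the size of `Z ─ T` minus the number of places off
-- `T` where `S` and `Z` disagree.
signs : Subset n → Subset n → Fin n → ℚ
signs T Z i = sign (lookup T i) (lookup Z i)

sign-maximal : ∀ t z s → sign t z ℚ.* indicator s ℚ.≤ sign t z ℚ.* indicator z
sign-maximal true  true  true  = from-yes (0ℚ ℚ.≤? 0ℚ)
sign-maximal true  true  false = from-yes (0ℚ ℚ.≤? 0ℚ)
sign-maximal true  false true  = from-yes (0ℚ ℚ.≤? 0ℚ)
sign-maximal true  false false = from-yes (0ℚ ℚ.≤? 0ℚ)
sign-maximal false true  true  = from-yes (1ℚ ℚ.≤? 1ℚ)
sign-maximal false true  false = from-yes (0ℚ ℚ.≤? 1ℚ)
sign-maximal false false true  = from-yes (-1ℚ ℚ.≤? 0ℚ)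
sign-maximal false false false = from-yes (0ℚ ℚ.≤? 0ℚ)

sign-gap : ∀ z s → s ≢ z → sign false z ℚ.* indicator s ℚ.+ 1ℚ ℚ.≤ sign false z ℚ.* indicator z
sign-gap true  true  s≢z = contradiction refl s≢z
sign-gap true  false _   = from-yes (1ℚ ℚ.≤? 1ℚ)
sign-gap false true  _   = from-yes (0ℚ ℚ.≤? 0ℚ)
sign-gap false false s≢z = contradiction refl s≢z

sign-near : ∀ t z s → sign t z ℚ.* indicator z ℚ.+ -1ℚ ℚ.≤ sign t z ℚ.* indicator s
sign-near true  true  true  = from-yes (-1ℚ ℚ.≤? 0ℚ)
sign-near true  true  false = from-yes (-1ℚ ℚ.≤? 0ℚ)
sign-near true  false true  = from-yes (-1ℚ ℚ.≤? 0ℚ)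
sign-near true  false false = from-yes (-1ℚ ℚ.≤? 0ℚ)
sign-near false true  true  = from-yes (0ℚ ℚ.≤? 1ℚ)
sign-near false true  false = from-yes (0ℚ ℚ.≤? 0ℚ)
sign-near false false true  = from-yes (-1ℚ ℚ.≤? -1ℚ)
sign-near false false false = from-yes (-1ℚ ℚ.≤? 0ℚ)

sign-free : ∀ z s s′ → sign true z ℚ.* indicator s ℚ.≤ sign true z ℚ.* indicator s′
sign-free z s s′ = ℚ.≤-reflexive (trans (ℚ.*-zeroˡ (indicator s)) (sym (ℚ.*-zeroˡ (indicator s′))))

AgreeOff : Subset n → Subset n → Subset n → Set
AgreeOff T S Z = ∀ i → i ∉ T → lookup S i ≡ lookup Z i

∉⇒lookup : i ∉ S → lookup S i ≡ false
∉⇒lookup {i = i} {S = S} i∉S = Bool.¬-not (i∉S ∘ lookup⇒[]= i S)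

weight-gap : ∀ (T Z S : Subset n) → i ∉ T → lookup S i ≢ lookup Z i →
             weight (signs T Z) S ℚ.+ 1ℚ ℚ.≤ weight (signs T Z) Z
weight-gap {i = i} T Z S i∉T S≢Z = sumℚ-mono-≤-at
  (λ j → signs T Z j ℚ.* indicator (lookup S j)) (λ j → signs T Z j ℚ.* indicator (lookup Z j)) 1ℚ i
  (subst (λ t → sign t (lookup Z i) ℚ.* indicator (lookup S i) ℚ.+ 1ℚ ℚ.≤ sign t (lookup Z i) ℚ.* indicator (lookup Z i))
    (sym (∉⇒lookup i∉T)) (sign-gap (lookup Z i) (lookup S i) S≢Z))
  (λ j _ → sign-maximal (lookup T j) (lookup Z j) (lookup S j))

weight-near : ∀ (T Z S : Subset n) c → AgreeOff (T ∪ ⁅ c ⁆) S Z →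
              weight (signs T Z) Z ℚ.+ -1ℚ ℚ.≤ weight (signs T Z) S
weight-near T Z S c agree = sumℚ-mono-≤-at
  (λ j → signs T Z j ℚ.* indicator (lookup Z j)) (λ j → signs T Z j ℚ.* indicator (lookup S j)) -1ℚ c
  (sign-near (lookup T c) (lookup Z c) (lookup S c)) elsewhere
  where
  elsewhere : ∀ j → j ≢ c → signs T Z j ℚ.* indicator (lookup Z j) ℚ.≤ signs T Z j ℚ.* indicator (lookup S j)
  elsewhere j j≢c with j ∈? T
  ... | yes j∈T rewrite []=⇒lookup j∈T = sign-free (lookup Z j) (lookup Z j) (lookup S j)
  ... | no j∉T = ℚ.≤-reflexive (cong (λ s → signs T Z j ℚ.* indicator s) (sym (agree j
          ([ j∉T , j≢c ∘ x∈⁅y⁆⇒x≡y c ]′ ∘ x∈p∪q⁻ T ⁅ c ⁆))))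

AgreeOff? : ∀ (T S Z : Subset n) → Dec (AgreeOff T S Z)
AgreeOff? T S Z = Fin.all? (λ i → ¬? (i ∈? T) →-dec (lookup S i Bool.≟ lookup Z i))

agreeOff⇒⊇ : ∀ (T S Z : Subset n) → AgreeOff T S Z → i ∉ T → i ∈ Z → i ∈ S
agreeOff⇒⊇ {i = i} T S Z agree i∉T i∈Z = lookup⇒[]= i S (trans (agree i i∉T) ([]=⇒lookup i∈Z))

-- The functional signs T Z attains its maximum over all subsets exactly at
-- those agreeing with Z off T, and drops by at least 1 elsewhere.
base-near : ∀ (N : Matroid n) → Decidable (Base N) → ∀ (T Z A C : Subset n) → P N (midpoint A C) →
  weight (signs T Z) Z ℚ.+ -1ℚ ℚ.< ½ ℚ.* weight (signs T Z) A ℚ.+ ½ ℚ.* weight (signs T Z) C →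
  Σ[ S ∈ Subset n ] Base N S × AgreeOff T S Z
base-near N N? T Z A C mid∈N heavy with anySubset? (λ S → N? S ×-dec AgreeOff? T S Z)
... | yes found = found
-- If no base agrees with `Z` off `T`, every base lies at least 1 below the maximum. By convexity so
-- does the midpoint, against `heavy`.
... | no none = contradiction
  (ℚ.<-≤-trans heavy (fromℚ-cancel-≤ (≤-trans (fromℚ mean) ((fromℚ ∘ signs T Z) · midpoint A C) (fromℚ value)
    (≈⇒≤ (R.sym (·-midpoint (signs T Z) A C))) (weight-bound N (signs T Z) value bound (midpoint A C) mid∈N))))
  (ℚ.<-irrefl refl)
  where
  mean value : ℚ
  mean = ½ ℚ.* weight (signs T Z) A ℚ.+ ½ ℚ.* weight (signs T Z) C
  value = weight (signs T Z) Z ℚ.+ -1ℚ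
  bound : ∀ S → Base N S → weight (signs T Z) S ℚ.≤ value
  bound S bS with Fin.any? (λ i → ¬? (i ∈? T) ×-dec ¬? (lookup S i Bool.≟ lookup Z i))
  ... | yes (i , i∉T , S≢Z) = subst (ℚ._≤ value) (cancel (weight (signs T Z) S))
          (ℚ.+-monoˡ-≤ -1ℚ (weight-gap T Z S i∉T S≢Z))
    where
    cancel : ∀ p → (p ℚ.+ 1ℚ) ℚ.+ -1ℚ ≡ p
    cancel = solve 1 (λ p → (p :+ con 1ℚ) :+ con -1ℚ := p) refl where open +-*-Solver
  ... | no agree = contradiction
          (S , bS , λ i i∉T → decidable-stable (lookup S i Bool.≟ lookup Z i) (λ S≢Z → agree (i , i∉T , S≢Z))) none

-- Bases forced by midpoints.

pred<mean : ∀ a z → z ℚ.+ -1ℚ ℚ.≤ a → z ℚ.+ -1ℚ ℚ.< ½ ℚ.* a ℚ.+ ½ ℚ.* z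
pred<mean a z z-1≤a = subst (ℚ._< ½ ℚ.* a ℚ.+ ½ ℚ.* z) (halves (z ℚ.+ -1ℚ))
  (ℚ.+-mono-≤-< (ℚ.*-monoˡ-≤-nonNeg ½ z-1≤a) (ℚ.*-monoʳ-<-pos ½ z-1<z))
  where
  z-1<z : z ℚ.+ -1ℚ ℚ.< z
  z-1<z = subst (z ℚ.+ -1ℚ ℚ.<_) (ℚ.+-identityʳ z) (ℚ.+-monoʳ-< z (from-yes (-1ℚ ℚ.<? 0ℚ)))

midpoint-near : ∀ (N : Matroid n) → Decidable (Base N) → ∀ T A C c → AgreeOff (T ∪ ⁅ c ⁆) A C →
  P N (midpoint A C) ⊎ P N (midpoint C A) → Σ[ S ∈ Subset n ] Base N S × AgreeOff T S C
midpoint-near N N? T A C c agree (inj₁ AC∈N) =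
  base-near N N? T C A C AC∈N (pred<mean (weight (signs T C) A) (weight (signs T C) C) (weight-near T C A c agree))
midpoint-near N N? T A C c agree (inj₂ CA∈N) =
  base-near N N? T C C A CA∈N (subst (weight (signs T C) C ℚ.+ -1ℚ ℚ.<_)
    (ℚ.+-comm (½ ℚ.* weight (signs T C) A) (½ ℚ.* weight (signs T C) C))
    (pred<mean (weight (signs T C) A) (weight (signs T C) C) (weight-near T C A c agree)))

vertex∈P⇒base : ∀ (N : Matroid n) → Decidable (Base N) → ∀ S → P N (midpoint S S) → Base N S
-- An empty ground set has no coordinate to pass as `c`, but its only subset is the base given by
-- `nonempty`.
vertex∈P⇒base {zero}  N N? [] _ with nonempty N
... | [] , b = b
vertex∈P⇒base {suc n} N N? S mid∈N =
  let T , bT , agree = midpoint-near N N? Subset.⊥ S S zero (λ _ _ → refl) (inj₁ mid∈N)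
  in subst (Base N)
       (⊆-antisym (agreeOff⇒⊇ Subset.⊥ S T (λ i i∉ → sym (agree i i∉)) ∉⊥) (agreeOff⇒⊇ Subset.⊥ T S agree ∉⊥)) bT

-- The functional ignores `a`: counting both `a` and `c` could bring the mean down to exactly 1
-- below the maximum. The base found agrees with `C` off `a`, so it contains `C` and equals it by
-- maximality in `M`.
endpoint : ∀ (M N : Matroid n) → Decidable (Base N) → (∀ {S} → Base N S → Base M S) → ∀ A C {a c} →
  Base M C → (∀ {i} → i ∈ A → i ∉ C → i ≡ a) → (∀ {i} → i ∈ C → i ∉ A → i ≡ c) → a ∉ C →
  P N (midpoint A C) ⊎ P N (midpoint C A) → Base N C
endpoint M N N? N⊆M A C {a} {c} bC A─C C─A a∉C mid∈N =
  let S , bS , near = midpoint-near N N? ⁅ a ⁆ A C c agree mid∈N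
      C⊆S : C ⊆ S
      C⊆S = λ i∈C → agreeOff⇒⊇ ⁅ a ⁆ S C near (λ i∈a → a∉C (subst (_∈ C) (x∈⁅y⁆⇒x≡y a i∈a) i∈C)) i∈C
  in subst (Base N) (base-maximal M bC (N⊆M bS) C⊆S) bS
  where
  agree : AgreeOff (⁅ a ⁆ ∪ ⁅ c ⁆) A C
  agree i i∉ with i ∈? A | i ∈? C
  ... | yes i∈A | yes i∈C = trans ([]=⇒lookup i∈A) (sym ([]=⇒lookup i∈C))
  ... | no i∉A  | no i∉C  = trans (∉⇒lookup i∉A) (sym (∉⇒lookup i∉C))
  ... | yes i∈A | no i∉C  = contradiction (x∈p∪q⁺ (inj₁ (subst (_∈ ⁅ a ⁆) (sym (A─C i∈A i∉C)) (x∈⁅x⁆ a)))) i∉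
  ... | no i∉A  | yes i∈C = contradiction (x∈p∪q⁺ (inj₂ (subst (_∈ ⁅ c ⁆) (sym (C─A i∈C i∉A)) (x∈⁅x⁆ c)))) i∉

-- Subset n is finite, so double negation commutes with quantification over it.
¬¬-decidable : ∀ {n} (Q : Pred (Subset n) 0ℓ) → ¬ ¬ (∀ S → Dec (Q S))
¬¬-decidable {zero}  Q ¬dec = ¬¬-excluded-middle λ Q? → ¬dec λ { [] → Q? }
¬¬-decidable {suc n} Q ¬dec =
  ¬¬-decidable (Q ∘ (Subset.inside ∷_)) λ in? → ¬¬-decidable (Q ∘ (Subset.outside ∷_)) λ out? →
    ¬dec λ { (Subset.inside ∷ S) → in? S ; (Subset.outside ∷ S) → out? S }

-- From a split of polytopes to a cover of bases.

P-mono : ∀ (M N : Matroid n) → (∀ {S} → Base M S → Base N S) → ∀ x → P M x → P N x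
P-mono M N M⊆N x (k , v , w , v∈ , rest) =
  k , v , w , (λ j → let B , bB , v≃B = v∈ j in B , M⊆N bB , v≃B) , rest

-- If every base of `M` were a base of `N`, the two polytopes would coincide. Decidability turns
-- this refutation into a search over finitely many subsets.
escaping-base : ∀ (M N : Matroid n) → Decidable (Base M) → Decidable (Base N) → (∀ x → P N x → P M x) →
                ¬ (P N ≐ P M) → Σ[ S ∈ Subset n ] Base M S × ¬ Base N S
escaping-base M N M? N? PN⊆PM PN≢PM = decidable-stable (anySubset? (λ S → M? S ×-dec ¬? (N? S))) λ none →
  PN≢PM ((λ {x} → PN⊆PM x) , λ {x} → P-mono M N (λ {S} b → decidable-stable (N? S) (λ ¬b → none (S , b , ¬b))) x)

theorem3 : ∀ {n : ℕ} (M : Matroid n) → Binary M →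
    ¬ (Σ[ N₁ ∈ Matroid n ] Σ[ N₂ ∈ Matroid n ] Σ[ split ∈ HyperplaneSplit M N₁ N₂ ] Nontrivial split)
theorem3 M M-binary (N₁ , N₂ , split , P₁≢P , P₂≢P) =
  -- The goal is a negation, so the three base predicates may be assumed decidable.
  ¬¬-decidable (Base M) λ M? → ¬¬-decidable (Base N₁) λ N₁? → ¬¬-decidable (Base N₂) λ N₂? →
  let open HyperplaneSplit split
      N₁⊆M : ∀ {S} → Base N₁ S → Base M S
      N₁⊆M {S} b = vertex∈P⇒base M M? S (⊇-union {midpoint S S} (inj₁ (midpoint∈P N₁ S S b b)))
      N₂⊆M : ∀ {S} → Base N₂ S → Base M S
      N₂⊆M {S} b = vertex∈P⇒base M M? S (⊇-union {midpoint S S} (inj₂ (midpoint∈P N₂ S S b b)))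
      cover : ∀ {S} → Base M S → Base N₁ S ⊎ Base N₂ S
      -- The union is covered only up to double negation, which decidability of the bases removes.
      cover {S} b = decidable-stable (N₁? S ⊎-dec N₂? S) λ ¬covered → ⊆-union {midpoint S S} (midpoint∈P M S S b b)
        (¬covered ∘ Sum.map (vertex∈P⇒base N₁ N₁? S) (vertex∈P⇒base N₂ N₂? S))
      -- Properness of `P N₂` yields a base outside `N₂`, which `cover` places in `N₁`. The next
      -- line is symmetric.
      A , A∈M , A∉N₂ = escaping-base M N₂ M? N₂? (λ x → ⊇-union {x} ∘ inj₂) P₂≢P
      C , C∈M , C∉N₁ = escaping-base M N₁ M? N₁? (λ x → ⊇-union {x} ∘ inj₁) P₁≢P
  in Separation.not-separated M N₁ N₂ M-binary N₁? N₁⊆M N₂⊆M cover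
       (λ {A} {C} bA bC A─C C─A a∉C c∉A → decidable-stable (N₂? A ⊎-dec N₁? C) λ ¬edge →
         -- A midpoint in `P N₁` makes `C` a base of `N₁`, and one in `P N₂` makes `A` a base of
         -- `N₂`.
         ⊆-union {midpoint A C} (midpoint∈P M A C (N₁⊆M bA) (N₂⊆M bC)) λ
           { (inj₁ mid∈N₁) → ¬edge (inj₂ (endpoint M N₁ N₁? N₁⊆M A C (N₂⊆M bC) A─C C─A a∉C (inj₁ mid∈N₁)))
           ; (inj₂ mid∈N₂) → ¬edge (inj₁ (endpoint M N₂ N₂? N₂⊆M C A (N₁⊆M bA) C─A A─C c∉A (inj₂ mid∈N₂))) })
       A C (<-wellFounded _) (fromInj₁ (λ b → contradiction b A∉N₂) (cover A∈M)) A∉N₂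
       (fromInj₂ (λ b → contradiction b C∉N₁) (cover C∈M)) C∉N₁
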